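{- Let $\mathbb B=(A,\prec_1,\prec_2)$ be a bi-subordination algebra with $A$ a bounded distributive lattice. For $a\in A$ let $\Delta_{\prec_1}a$ be the ideal $\{b\in A\mid b\prec_1a\}$ and $\nabla_{\prec_2}a$ the filter $\{b\in A\mid a\prec_2b\}$. Then: (1) $\mathbb B$ satisfies (P1) if and only if $\Delta_{\prec_1}(a\vee b)\subseteq\nabla_{\prec_2}a\odot\Delta_{\prec_1}b$ for all $a,b\in A$; (2) $\mathbb B$ satisfies (P2) if and only if $\nabla_{\prec_2}(a\wedge b)\subseteq\Delta_{\prec_1}a\oplus\nabla_{\prec_2}b$ for all $a,b\in A$.
   Context: A bi-subordination algebra is $(A,\prec_1,\prec_2)$ such that each $\prec\,\in\{\prec_1,\prec_2\}$ is a subordination relation: $\bot\prec\bot$; $\top\prec\top$; $a\le b\prec x\Rightarrow a\prec x$; $b\prec x\le y\Rightarrow b\prec y$; $a\prec x\ \&\ a\prec y\Rightarrow a\prec x\wedge y$; $a\prec x\ \&\ b\prec x\Rightarrow a\vee b\prec x$. For a filter $F$ and an ideal $I$ of $A$: $F\odot I:=\bigcap\{\mathrm{Id}(I\cup\{a\})\mid a\in F\}$ and $I\oplus F:=\bigcap\{\mathrm{Fil}(F\cup\{a\})\mid a\in I\}$, where $\mathrm{Id}(X)$ and $\mathrm{Fil}(X)$ denote the ideal and the filter of $A$ generated by $X$. (P1) For all $a,b,c\in A$: $c\prec_1a\vee b\Rightarrow\forall d[a\prec_2d\Rightarrow\exists e(e\prec_1b\ \&\ c\le e\vee d)]$. (P2)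 For all $a,b,c\in A$: $a\wedge b\prec_2c\Rightarrow\forall d[d\prec_1a\Rightarrow\exists e(b\prec_2e\ \&\ d\wedge e\le c)]$. -}

module Defs where

open import Data.Product.Base using (_×_; ∃-syntax)
open import Level using (Level; _⊔_; suc)
open import Relation.Binary.Core using (Rel)
open import Relation.Binary.Lattice using (BoundedLattice)
open import Relation.Unary using (Pred; _∈_; _⊆_; _∪_)

module IdealsFilters {c ℓ₁ ℓ₂ : Level} (L : BoundedLattice c ℓ₁ ℓ₂) where
  open BoundedLattice L

  record IsIdeal {ℓ : Level} (I : Pred Carrier ℓ) : Set (c ⊔ ℓ₂ ⊔ ℓ) where
    field
      ⊥-mem    : ⊥ ∈ I
      ∨-closed : ∀ {x y} → x ∈ I → y ∈ I → x ∨ y ∈ I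
      ↓-closed : ∀ {x y} → x ≤ y → y ∈ I → x ∈ I

  record IsFilter {ℓ : Level} (F : Pred Carrier ℓ) : Set (c ⊔ ℓ₂ ⊔ ℓ) where
    field
      ⊤-mem    : ⊤ ∈ F
      ∧-closed : ∀ {x y} → x ∈ F → y ∈ F → x ∧ y ∈ F
      ↑-closed : ∀ {x y} → x ≤ y → x ∈ F → y ∈ F

  record Ideal (ℓ : Level) : Set (c ⊔ ℓ₂ ⊔ suc ℓ) where
    field
      members : Pred Carrier ℓ
      isIdeal : IsIdeal members
    open IsIdeal isIdeal public

  record Filter (ℓ : Level) : Set (c ⊔ ℓ₂ ⊔ suc ℓ) where
    field
      members  : Pred Carrier ℓ
      isFilter : IsFilter members
    open IsFilter isFilter public

  -- The generated ideal and filter are given inductively, which avoids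
  -- quantifying over all ideals (filters) of a fixed universe level.
  -- That they are the least ones containing X is Id-isIdeal, Id-least,
  -- Fil-isFilter and Fil-least below.
  data Id {ℓ : Level} (X : Pred Carrier ℓ) : Pred Carrier (c ⊔ ℓ₂ ⊔ ℓ) where
    gen    : ∀ {x} → x ∈ X → x ∈ Id X
    bottom : ⊥ ∈ Id X
    join   : ∀ {x y} → x ∈ Id X → y ∈ Id X → x ∨ y ∈ Id X
    down   : ∀ {x y} → x ≤ y → y ∈ Id X → x ∈ Id X

  data Fil {ℓ : Level} (X : Pred Carrier ℓ) : Pred Carrier (c ⊔ ℓ₂ ⊔ ℓ) where
    gen  : ∀ {x} → x ∈ X → x ∈ Fil X
    top  : ⊤ ∈ Fil X
    meet : ∀ {x y} → x ∈ Fil X → y ∈ Fil X → x ∧ y ∈ Fil X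
    up   : ∀ {x y} → x ≤ y → x ∈ Fil X → y ∈ Fil X

  Id-isIdeal : ∀ {ℓ} (X : Pred Carrier ℓ) → IsIdeal (Id X)
  Id-isIdeal X = record { ⊥-mem = bottom ; ∨-closed = join ; ↓-closed = down }

  Id-least : ∀ {ℓ ℓ′} {X : Pred Carrier ℓ} {J : Pred Carrier ℓ′} →
             IsIdeal J → X ⊆ J → Id X ⊆ J
  Id-least J X⊆J (gen x∈X)  = X⊆J x∈X
  Id-least J X⊆J bottom     = IsIdeal.⊥-mem J
  Id-least J X⊆J (join p q) = IsIdeal.∨-closed J (Id-least J X⊆J p) (Id-least J X⊆J q)
  Id-least J X⊆J (down l p) = IsIdeal.↓-closed J l (Id-least J X⊆J p)

  Fil-isFilter : ∀ {ℓ} (X : Pred Carrier ℓ) → IsFilter (Fil X)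
  Fil-isFilter X = record { ⊤-mem = top ; ∧-closed = meet ; ↑-closed = up }

  Fil-least : ∀ {ℓ ℓ′} {X : Pred Carrier ℓ} {G : Pred Carrier ℓ′} →
              IsFilter G → X ⊆ G → Fil X ⊆ G
  Fil-least G X⊆G (gen x∈X)  = X⊆G x∈X
  Fil-least G X⊆G top        = IsFilter.⊤-mem G
  Fil-least G X⊆G (meet p q) = IsFilter.∧-closed G (Fil-least G X⊆G p) (Fil-least G X⊆G q)
  Fil-least G X⊆G (up l p)   = IsFilter.↑-closed G l (Fil-least G X⊆G p)

  infixr 6 _⊙_ _⊕_

  -- The singleton {a} is (a ≈_), since _≈_ is the equality of the lattice.
  _⊙_ : ∀ {ℓ ℓ′} → Filter ℓ → Ideal ℓ′ → Pred Carrier (c ⊔ ℓ₁ ⊔ ℓ₂ ⊔ ℓ ⊔ ℓ′)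
  (F ⊙ I) x = ∀ a → a ∈ Filter.members F → x ∈ Id (Ideal.members I ∪ (a ≈_))

  _⊕_ : ∀ {ℓ ℓ′} → Ideal ℓ → Filter ℓ′ → Pred Carrier (c ⊔ ℓ₁ ⊔ ℓ₂ ⊔ ℓ ⊔ ℓ′)
  (I ⊕ F) x = ∀ a → a ∈ Ideal.members I → x ∈ Fil (Filter.members F ∪ (a ≈_))

record IsSubordination {c ℓ₁ ℓ₂ ℓ : Level} (L : BoundedLattice c ℓ₁ ℓ₂)
                       (_≺_ : Rel (BoundedLattice.Carrier L) ℓ) :
                       Set (c ⊔ ℓ₂ ⊔ ℓ) where
  open BoundedLattice L
  field
    ⊥≺⊥     : ⊥ ≺ ⊥
    ⊤≺⊤     : ⊤ ≺ ⊤
    ≤-≺     : ∀ {a b x} → a ≤ b → b ≺ x → a ≺ x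
    ≺-≤     : ∀ {b x y} → b ≺ x → x ≤ y → b ≺ y
    ≺-∧     : ∀ {a x y} → a ≺ x → a ≺ y → a ≺ (x ∧ y)
    ∨-≺     : ∀ {a b x} → a ≺ x → b ≺ x → (a ∨ b) ≺ x

record BiSubordinationAlgebra (c ℓ₁ ℓ₂ ℓ₃ ℓ₄ : Level) :
                              Set (suc (c ⊔ ℓ₁ ⊔ ℓ₂ ⊔ ℓ₃ ⊔ ℓ₄)) where
  infix 4 _≺₁_ _≺₂_
  field
    boundedLattice : BoundedLattice c ℓ₁ ℓ₂
  open BoundedLattice boundedLattice public
  open IdealsFilters boundedLattice public
  field
    _≺₁_             : Rel Carrier ℓ₃
    _≺₂_             : Rel Carrier ℓ₄
    isSubordination₁ : IsSubordination boundedLattice _≺₁_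
    isSubordination₂ : IsSubordination boundedLattice _≺₂_

  Δ₁ : Carrier → Ideal ℓ₃
  Δ₁ a = record
    { members = _≺₁ a
    ; isIdeal = record
      { ⊥-mem    = ≺-≤ ⊥≺⊥ (minimum a)
      ; ∨-closed = ∨-≺
      ; ↓-closed = ≤-≺
      }
    }
    where open IsSubordination isSubordination₁

  ∇₂ : Carrier → Filter ℓ₄
  ∇₂ a = record
    { members  = a ≺₂_
    ; isFilter = record
      { ⊤-mem    = ≤-≺ (maximum a) ⊤≺⊤
      ; ∧-closed = ≺-∧
      ; ↑-closed = λ x≤y a≺x → ≺-≤ a≺x x≤y
      }
    }
    where open IsSubordination isSubordination₂

  P1 : Set (c ⊔ ℓ₂ ⊔ ℓ₃ ⊔ ℓ₄)
  P1 = ∀ a b c → c ≺₁ a ∨ b →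
       ∀ d → a ≺₂ d → ∃[ e ] (e ≺₁ b × c ≤ e ∨ d)

  P2 : Set (c ⊔ ℓ₂ ⊔ ℓ₃ ⊔ ℓ₄)
  P2 = ∀ a b c → a ∧ b ≺₂ c →
       ∀ d → d ≺₁ a → ∃[ e ] (b ≺₂ e × d ∧ e ≤ c)

{-# OPTIONS --safe #-}
-- An element x lies in Id(I ∪ {a}) iff x ≤ e ∨ a for some e ∈ I, and dually
-- x lies in Fil(F ∪ {a}) iff a ∧ e ≤ x for some e ∈ F.  Under these
-- descriptions the inclusions are (P1) and (P2) with quantifiers regrouped.
module Submission where

open import Defs
open import Level using (Level)
open import Data.Product.Base using (_×_; _,_; ∃-syntax)
open import Data.Sum.Base using (inj₁; inj₂)
open import Function.Bundles using (_⇔_; mk⇔; Equivalence)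
open import Relation.Binary.Lattice using (BoundedLattice; IsDistributiveLattice)
import Relation.Binary.Lattice.Properties.JoinSemilattice as JoinProperties
import Relation.Binary.Lattice.Properties.MeetSemilattice as MeetProperties
open import Relation.Unary using (_∈_; _⊆_; _∪_)

module Adjoining {c ℓ₁ ℓ₂ : Level} (L : BoundedLattice c ℓ₁ ℓ₂) where
  open BoundedLattice L
  open IdealsFilters L
  open JoinProperties joinSemilattice using (∨-monotonic)
  open MeetProperties meetSemilattice using (∧-monotonic)

  -- The elements below some `e ∨ a` with `e ∈ I` already form an ideal containing `I` and `a`, so
  -- leastness of `Id` gives one direction; each `e ∨ a` is a join of two generators, which gives
  -- the other.
  ∈-Id-adjoin : ∀ {ℓ} (I : Ideal ℓ) {a x} →
                x ∈ Id (Ideal.members I ∪ (a ≈_)) ⇔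
                (∃[ e ] (e ∈ Ideal.members I × x ≤ e ∨ a))
  ∈-Id-adjoin I {a} = mk⇔ (Id-least isIdeal′ members′) λ where
      (e , e∈I , x≤e∨a) → down x≤e∨a (join (gen (inj₁ e∈I)) (gen (inj₂ Eq.refl)))
    where
    open Ideal I
    isIdeal′ : IsIdeal (λ x → ∃[ e ] (e ∈ members × x ≤ e ∨ a))
    isIdeal′ = record
      { ⊥-mem    = ⊥ , ⊥-mem , minimum _
      ; ∨-closed = λ (e , e∈I , x≤) (f , f∈I , y≤) →
          -- Both `e ∨ a` and `f ∨ a` lie below `(e ∨ f) ∨ a`, so one witness bounds `x` and `y`
          -- together.
          e ∨ f , ∨-closed e∈I f∈I ,
          ∨-least (trans x≤ (∨-monotonic (x≤x∨y e f) refl))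
                  (trans y≤ (∨-monotonic (y≤x∨y e f) refl))
      ; ↓-closed = λ x≤y (e , e∈I , y≤) → e , e∈I , trans x≤y y≤
      }
    members′ : members ∪ (a ≈_) ⊆ (λ x → ∃[ e ] (e ∈ members × x ≤ e ∨ a))
    members′ (inj₁ x∈I) = _ , x∈I , x≤x∨y _ a
    -- The adjoined element needs no help from `I`, so the least member is enough.
    members′ (inj₂ a≈x) = ⊥ , ⊥-mem , trans (reflexive (Eq.sym a≈x)) (y≤x∨y ⊥ a)

  -- Order dual of `∈-Id-adjoin`, with `a` on the left of the meet so that the bound has the shape
  -- `d ∧ e ≤ c` of `P2`.
  ∈-Fil-adjoin : ∀ {ℓ} (F : Filter ℓ) {a x} →
                 x ∈ Fil (Filter.members F ∪ (a ≈_)) ⇔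
                 (∃[ e ] (e ∈ Filter.members F × a ∧ e ≤ x))
  ∈-Fil-adjoin F {a} = mk⇔ (Fil-least isFilter′ members′) λ where
      (e , e∈F , a∧e≤x) → up a∧e≤x (meet (gen (inj₂ Eq.refl)) (gen (inj₁ e∈F)))
    where
    open Filter F
    isFilter′ : IsFilter (λ x → ∃[ e ] (e ∈ members × a ∧ e ≤ x))
    isFilter′ = record
      { ⊤-mem    = ⊤ , ⊤-mem , maximum _
      ; ∧-closed = λ (e , e∈F , ≤x) (f , f∈F , ≤y) →
          e ∧ f , ∧-closed e∈F f∈F ,
          ∧-greatest (trans (∧-monotonic refl (x∧y≤x e f)) ≤x)
                     (trans (∧-monotonic refl (x∧y≤y e f)) ≤y)
      ; ↑-closed = λ x≤y (e , e∈F , ≤x) → e , e∈F , trans ≤x x≤y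
      }
    members′ : members ∪ (a ≈_) ⊆ (λ x → ∃[ e ] (e ∈ members × a ∧ e ≤ x))
    members′ (inj₁ x∈F) = _ , x∈F , x∧y≤y a _
    members′ (inj₂ a≈x) = ⊤ , ⊤-mem , trans (x∧y≤x a ⊤) (reflexive a≈x)

mainTheorem10 : ∀ {c ℓ₁ ℓ₂ ℓ₃ ℓ₄ : Level} (B : BiSubordinationAlgebra c ℓ₁ ℓ₂ ℓ₃ ℓ₄) →
    let open BiSubordinationAlgebra B in
    IsDistributiveLattice _≈_ _≤_ _∨_ _∧_ →
    (P1 ⇔ (∀ a b → Ideal.members (Δ₁ (a ∨ b)) ⊆ (∇₂ a ⊙ Δ₁ b)))
    ×
    (P2 ⇔ (∀ a b → Filter.members (∇₂ (a ∧ b)) ⊆ (Δ₁ a ⊕ ∇₂ b)))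
mainTheorem10 B _ =
    -- Membership in `∇₂ a ⊙ Δ₁ b` is a function of each `d` with `a ≺₂ d`: this `d` is the element
    -- adjoined to `Δ₁ b`, and `e` is drawn from `Δ₁ b`.
    mk⇔ (λ p1 a b {c} c≺a∨b d a≺d → from (∈-Id-adjoin (Δ₁ b)) (p1 a b c c≺a∨b d a≺d))
        (λ Δ⊆ a b c c≺a∨b d a≺d → to (∈-Id-adjoin (Δ₁ b)) (Δ⊆ a b c≺a∨b d a≺d))
  -- Here `d` ranges over `Δ₁ a` and is adjoined to `∇₂ b`, which supplies `e`.
  , mk⇔ (λ p2 a b {c} a∧b≺c d d≺a → from (∈-Fil-adjoin (∇₂ b)) (p2 a b c a∧b≺c d d≺a))
        (λ ∇⊆ a b c a∧b≺c d d≺a → to (∈-Fil-adjoin (∇₂ b)) (∇⊆ a b a∧b≺c d d≺a))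
  where
  open BiSubordinationAlgebra B
  open Adjoining boundedLattice
  open Equivalence using (to; from)
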